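{- Let $\mathbb{F}_q$ be a finite field with $q$ elements, let $d\ge 1$ be an integer and let $P(Z)\in\mathbb{F}_q[Z]$ with $\deg P\ge 2$. Let $$S_d(\mathbb{F}_q)=\{(\alpha,\beta,\gamma)\in\mathbb{F}_q^3\mid \alpha^d\beta=P(\gamma)\},\qquad N_0=\#\{\gamma\in\mathbb{F}_q\mid P(\gamma)=0\}.$$ Then $$|S_d(\mathbb{F}_q)|=qN_0+q(q-1)=q(q-1+N_0).$$
   Context: $S_d$ is the Danielewski surface $X^dY=P(Z)$ over $\mathbb{F}_q$, and $S_d(\mathbb{F}_q)$ is its set of $\mathbb{F}_q$-rational points. -}

module Defs where

open import Level using (_⊔_)
open import Algebra.Apartness.Bundles using (HeytingField; HeytingCommutativeRing)
open import Algebra.Bundles using (CommutativeRing)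
open import Data.Fin.Base using (Fin; toℕ)
open import Data.List.Base using (List; []; _∷_; length; lookup)
open import Data.Nat.Base using (ℕ; zero; suc; _<_)
open import Data.Product.Base using (Σ; _×_; _,_; proj₁)
open import Data.Product.Relation.Binary.Pointwise.NonDependent using (_×ₛ_)
open import Function.Bundles using (Inverse)
open import Relation.Binary.Bundles using (Setoid)
open import Relation.Binary.PropositionalEquality.Core using (_≡_)
open import Relation.Nullary.Negation.Core using (¬_)
import Algebra.Properties.Semiring.Exp as Exp
import Algebra.Properties.Semiring.Sum as Sum
import Relation.Binary.Construct.On as On
import Relation.Binary.PropositionalEquality.Properties as ≡

infix 4 _HasCardinality_

-- Elements are counted up to the setoid equality. The number n is unique.
_HasCardinality_ : ∀ {a ℓ} → Setoid a ℓ → ℕ → Set (a ⊔ ℓ)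
S HasCardinality n = Inverse S (≡.setoid (Fin n))

-- { x ∈ S ∣ P x }, with membership proofs ignored by the equality.
Subset : ∀ {a ℓ p} (S : Setoid a ℓ) → (Setoid.Carrier S → Set p) → Setoid (a ⊔ p) ℓ
Subset S P = On.setoid {B = Σ (Setoid.Carrier S) P} S proj₁

-- When the carrier is finite, equality and invertibility are decidable, so
-- a Heyting field is a field in the usual sense and _#_ is the negation of _≈_.
module _ {c ℓ₁ ℓ₂} (F : HeytingField c ℓ₁ ℓ₂) where

  open HeytingField F using (Carrier; _≈_; _*_; 0#; heytingCommutativeRing)
  open HeytingCommutativeRing heytingCommutativeRing using (commutativeRing)
  open CommutativeRing commutativeRing using (setoid; semiring)
  open Exp semiring using (_^_)
  open Sum semiring using (sum)

  fieldSetoid : Setoid c ℓ₁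
  fieldSetoid = setoid

  -- a₀ ∷ a₁ ∷ … ∷ aₙ ∷ [] stands for a₀ + a₁ Z + … + aₙ Zⁿ. Zero leading
  -- coefficients are allowed, so the length does not determine the degree.
  Polynomial : Set c
  Polynomial = List Carrier

  coeff : Polynomial → ℕ → Carrier
  coeff []      _       = 0#
  coeff (a ∷ _) zero    = a
  coeff (_ ∷ P) (suc i) = coeff P i

  HasDegree : Polynomial → ℕ → Set ℓ₁
  HasDegree P n = ¬ coeff P n ≈ 0# × (∀ i → n < i → coeff P i ≈ 0#)

  eval : Polynomial → Carrier → Carrier
  eval P z = sum (λ (i : Fin (length P)) → lookup P i * z ^ toℕ i)

  Roots : Polynomial → Setoid (c ⊔ ℓ₁) ℓ₁
  Roots P = Subset setoid (λ γ → eval P γ ≈ 0#)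

  -- The rational points of X ^ d * Y = P(Z).
  DanielewskiPoints : ℕ → Polynomial → Setoid (c ⊔ ℓ₁) ℓ₁
  DanielewskiPoints d P =
    Subset (setoid ×ₛ (setoid ×ₛ setoid)) (λ (α , β , γ) → α ^ d * β ≈ eval P γ)

{-# OPTIONS --safe #-}

-- When α = 0 the equation reads P(γ) = 0 and β is free, which gives q N₀ points.
-- When α ≠ 0 the coordinate β = P(γ) / α ^ d is determined by α and γ, which
-- gives q (q - 1) further points.
module Submission where

open import Defs
open import Algebra.Apartness.Bundles using (HeytingField; HeytingCommutativeRing)
open import Algebra.Bundles using (CommutativeRing)
open import Data.Fin.Base using (zero; suc; toℕ; punchIn; punchOut)
open import Data.Fin.Properties
  using (_≟_; any?; *↔×; +↔⊎; punchIn-injective; punchInᵢ≢i; punchIn-punchOut)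
open import Data.List.Base using (List; allFin; filter; length; lookup)
open import Data.List.Membership.Propositional.Properties
  using (∈-allFin; ∈-filter⁺; ∈-filter⁻; ∈-lookup)
open import Data.List.Relation.Unary.Any using (index)
open import Data.List.Relation.Unary.Any.Properties using (lookup-index)
open import Data.List.Relation.Unary.Unique.Propositional using (Unique; _∷_)
open import Data.List.Relation.Unary.Unique.Propositional.Properties
  using (allFin⁺; filter⁺)
open import Data.Nat.Base using (ℕ; zero; suc; _+_; _*_; _∸_; _≤_)
open import Data.Nat.Properties using (+-comm; *-distribˡ-+)
open import Data.Product.Base using (_×_; ∃-syntax; _,_; proj₁; proj₂)
open import Data.Product.Function.NonDependent.Setoid using (_×-inverse_)
open import Data.Product.Relation.Binary.Pointwise.NonDependent as × using (_×ₛ_)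
open import Data.Sum.Base using (inj₁; inj₂)
open import Data.Sum.Function.Setoid using (_⊎-inverse_)
open import Data.Sum.Relation.Binary.Pointwise as ⊎ using (_⊎ₛ_; inj₁; inj₂)
open import Function.Base using (_∘_)
open import Function.Bundles using (Injection; Inverse)
open import Function.Properties.Bijection using (Bijection⇒Inverse)
open import Level using (Level)
open import Relation.Binary.Bundles using (Setoid)
open import Relation.Binary.Definitions using (_Respects_) renaming (Decidable to Decidable₂)
open import Relation.Binary.PropositionalEquality.Core as ≡ using (_≡_; _≢_)
open import Relation.Nullary.Decidable using (Dec; yes; no; map′; via-injection)
open import Relation.Nullary.Negation.Core using (¬_; contradiction)
open import Relation.Unary using (Pred; Decidable)
import Algebra.Apartness.Properties.HeytingCommutativeRing as HeytingRingProperties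
import Algebra.Properties.CommutativeSemiring.Exp as Exp
import Algebra.Properties.Monoid.Mult as Mult
import Algebra.Properties.Semiring.Sum as Sum
import Data.List.Relation.Unary.All as All
import Function.Properties.Inverse as Inv
import Relation.Binary.Reasoning.Setoid as ≈-Reasoning

-- Project the surface to the `α`-coordinate. The fibre over 0 is the zero set of P(γ) with `β`
-- free; over a nonzero `α` the factor `α ^ d` is a unit, so the fibre is the graph of a function of
-- `γ`. Hence the point set is in bijection with the disjoint union of F × Roots and F × Nonzero
-- (`points-decomposition`), and counting products and sums gives q N₀ + q (q - 1). The number N₀
-- exists because a decidable subset of a finite setoid is finite (`decSubset-cardinality`).
-- Finiteness also makes equality decidable, which permits the case split on `α`, and makes nonzero
-- elements invertible in a Heyting field (`≉0⇒leftInverse`).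

private
  variable
    a b ℓ₁ ℓ₂ p : Level

lookup-injective : {A : Set a} {xs : List A} → Unique xs →
                   ∀ i j → lookup xs i ≡ lookup xs j → i ≡ j
lookup-injective (_ ∷ _)   zero    zero    _  = ≡.refl
lookup-injective (x∉ ∷ _)  zero    (suc j) eq = contradiction eq (All.lookup x∉ (∈-lookup j))
lookup-injective (x∉ ∷ _)  (suc i) zero    eq = contradiction (≡.sym eq) (All.lookup x∉ (∈-lookup i))
lookup-injective (_ ∷ xs!) (suc i) (suc j) eq = ≡.cong suc (lookup-injective xs! i j eq)

×-cardinality : {S : Setoid a ℓ₁} {T : Setoid b ℓ₂} {m n : ℕ} →
                S HasCardinality m → T HasCardinality n →
                (S ×ₛ T) HasCardinality (m * n)
×-cardinality ∣S∣ ∣T∣ =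
  Inv.trans (∣S∣ ×-inverse ∣T∣) (Inv.trans ×.Pointwise-≡↔≡ (Inv.sym *↔×))

⊎-cardinality : {S : Setoid a ℓ₁} {T : Setoid b ℓ₂} {m n : ℕ} →
                S HasCardinality m → T HasCardinality n →
                (S ⊎ₛ T) HasCardinality (m + n)
⊎-cardinality ∣S∣ ∣T∣ =
  Inv.trans (∣S∣ ⊎-inverse ∣T∣) (Inv.trans (⊎.Pointwise-≡↔≡ _ _) (Inv.sym +↔⊎))

module _ {S : Setoid a ℓ₁} {n : ℕ} (∣S∣ : S HasCardinality n) where

  open Setoid S
  open Inverse ∣S∣

  private
    from-injective : ∀ {i j} → from i ≈ from j → i ≡ j
    from-injective {i} {j} eq =
      ≡.trans (≡.sym (strictlyInverseˡ i)) (≡.trans (to-cong eq) (strictlyInverseˡ j))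

  finite⇒decidable : Decidable₂ _≈_
  finite⇒decidable = via-injection (Inv.Inverse⇒Injection ∣S∣) _≟_

  -- Exhaustive search over the indices. A witness `x` is only found as the representative
  -- `from (to x)`, which is why the predicate must respect the equality.
  finite⇒any? : {P : Pred Carrier p} → P Respects _≈_ → Decidable P →
                Dec (∃[ x ] P x)
  finite⇒any? resp P? = map′
    (λ (i , Pi) → from i , Pi)
    (λ (x , Px) → to x , resp (sym (strictlyInverseʳ x)) Px)
    (any? (P? ∘ from))

  -- Filtering the list of all indices keeps it free of repetitions, so its positions enumerate the
  -- subset bijectively and its length is the cardinality.
  decSubset-cardinality : {P : Pred Carrier p} → P Respects _≈_ → Decidable P →
                          ∃[ k ] Subset S P HasCardinality k
  decSubset-cardinality {P = P} resp P? = length is , Inv.sym (Bijection⇒Inverse record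
    { to        = λ j → from (lookup is j) , proj₂ (∈-filter⁻ Pfrom? {xs = allFin n} (∈-lookup j))
    ; cong      = λ { ≡.refl → refl }
    ; bijective =
        (λ eq → lookup-injective (filter⁺ Pfrom? (allFin⁺ n)) _ _ (from-injective eq))
      , λ (x , Px) →
          let x∈is = ∈-filter⁺ Pfrom? (∈-allFin (to x)) (resp (sym (strictlyInverseʳ x)) Px)
          in index x∈is , λ { ≡.refl →
               trans (from-cong (≡.sym (lookup-index x∈is))) (strictlyInverseʳ x) }
    })
    where
    Pfrom? : Decidable (P ∘ from)
    Pfrom? i = P? (from i)

    is = filter Pfrom? (allFin n)

-- `punchIn (to x)` enumerates the indices other than that of `x`. Truncated subtraction does no
-- harm: the element `x` itself excludes `n = zero`.
remove-cardinality : {S : Setoid a ℓ₁} {n : ℕ} → S HasCardinality n →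
                     let open Setoid S in
                     ∀ x → Subset S (λ y → ¬ y ≈ x) HasCardinality (n ∸ 1)
remove-cardinality {n = zero} ∣S∣ x with () ← Inverse.to ∣S∣ x
remove-cardinality {S = S} {n = suc n} ∣S∣ x = Inv.sym (Bijection⇒Inverse record
  { to        = λ j → from (punchIn (to x) j) , λ eq →
                  punchInᵢ≢i (to x) j (≡.trans (≡.sym (strictlyInverseˡ _)) (to-cong eq))
  ; cong      = λ { ≡.refl → refl }
  ; bijective =
      (λ {i} {j} eq → punchIn-injective (to x) i j
        (≡.trans (≡.sym (strictlyInverseˡ _)) (≡.trans (to-cong eq) (strictlyInverseˡ _))))
    , λ (y , y≉x) →
        let to-x≢to-y : to x ≢ to y
            to-x≢to-y eq = y≉x (sym (Injection.injective (Inv.Inverse⇒Injection ∣S∣) eq))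
        in punchOut to-x≢to-y , λ { ≡.refl →
             trans (from-cong (punchIn-punchOut to-x≢to-y)) (strictlyInverseʳ y) }
  })
  where
  open Setoid S
  open Inverse ∣S∣

module _ {c} (F : HeytingField c ℓ₁ ℓ₂) where

  open HeytingField F hiding (_+_; _*_)
  open HeytingField F using () renaming (_*_ to _·_)
  open HeytingCommutativeRing heytingCommutativeRing using (commutativeRing)
  open CommutativeRing commutativeRing using (semiring; commutativeSemiring; *-monoid)
  open HeytingRingProperties heytingCommutativeRing using (x-0≈x)
  open Exp commutativeSemiring using (_^_; ^-congˡ; ^-distrib-*)
  open Sum semiring using (sum-cong-≋)
  open ≈-Reasoning setoid

  eval-cong : ∀ P {y z} → y ≈ z → eval F P y ≈ eval F P z
  eval-cong P y≈z = sum-cong-≋ {length P} λ i → *-congˡ (^-congˡ (toℕ i) y≈z)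

  leftInverse⇒cancelˡ : ∀ {u v} → v · u ≈ 1# → ∀ x y → u · x ≈ u · y → x ≈ y
  leftInverse⇒cancelˡ {u} {v} vu≈1 x y ux≈uy = begin
    x            ≈⟨ *-identityˡ x ⟨
    1# · x       ≈⟨ *-congʳ vu≈1 ⟨
    v · u · x    ≈⟨ *-assoc v u x ⟩
    v · (u · x)  ≈⟨ *-congˡ ux≈uy ⟩
    v · (u · y)  ≈⟨ *-assoc v u y ⟨
    v · u · y    ≈⟨ *-congʳ vu≈1 ⟩
    1# · y       ≈⟨ *-identityˡ y ⟩
    y            ∎

  ^-leftInverse : ∀ {u v} → v · u ≈ 1# → ∀ m → v ^ suc m · u ^ suc m ≈ 1#
  ^-leftInverse {u} {v} vu≈1 m = begin
    v ^ suc m · u ^ suc m  ≈⟨ ^-distrib-* v u (suc m) ⟨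
    (v · u) ^ suc m        ≈⟨ ^-congˡ (suc m) vu≈1 ⟩
    -- Powers are iterated multiples in the multiplicative monoid, where `1#` is idempotent.
    1# ^ suc m             ≈⟨ Mult.×-idem *-monoid (*-identityˡ 1#) (suc m) ⟩
    1#                     ∎

  0^suc*x≈0 : ∀ m x → 0# ^ suc m · x ≈ 0#
  0^suc*x≈0 m x = trans (*-congʳ (zeroˡ (0# ^ m))) (zeroˡ x)

  module _ {q : ℕ} (∣F∣ : fieldSetoid F HasCardinality q) where

    private
      _≈?_ : Decidable₂ _≈_
      _≈?_ = finite⇒decidable ∣F∣

    -- Apartness from 0 is not decidable a priori, but the existence of an
    -- inverse is, and tightness then gives inverses of all nonzero elements.
    ≉0⇒leftInverse : ∀ {x} → ¬ x ≈ 0# → ∃[ y ] y · x ≈ 1#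
    ≉0⇒leftInverse {x} x≉0
      with finite⇒any? ∣F∣ (λ y≈z yx≈1 → trans (*-congʳ (sym y≈z)) yx≈1) (λ y → (y · x) ≈? 1#)
    ... | yes inverse  = inverse
    ... | no  ¬inverse = contradiction (proj₁ (tight x 0#) ¬x#0) x≉0
      where
      ¬x#0 : ¬ x # 0#
      -- Apartness provides an inverse of the difference `x - 0#`, which is then rewritten to `x`.
      ¬x#0 x#0 with y , y[x-0]≈1 , _ ← #⇒invertible x#0 =
        ¬inverse (y , trans (*-congˡ (sym (x-0≈x x))) y[x-0]≈1)

    Nonzero : Setoid _ _
    Nonzero = Subset setoid (λ x → ¬ x ≈ 0#)

    -- The two images are disjoint because only the first has `α ≈ 0#`. The exponent is a successor
    -- because the fibre over 0 consists of roots only when `0# ^ d` vanishes; at exponent 0 the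
    -- equation would be β = P(γ).
    points-decomposition : ∀ m P →
      Inverse ((setoid ×ₛ Roots F P) ⊎ₛ (setoid ×ₛ Nonzero)) (DanielewskiPoints F (suc m) P)
    points-decomposition m P = Bijection⇒Inverse record
      { to        = point
      ; cong      = point-cong
      ; bijective = point-injective , λ y →
          let x , point-x≈y = point-surjective y
          in x , λ {z} z≈x → Points.trans {point z} {point x} {y} (point-cong z≈x) point-x≈y
      }
      where
      d = suc m

      module Pieces = Setoid ((setoid ×ₛ Roots F P) ⊎ₛ (setoid ×ₛ Nonzero))
      module Points = Setoid (DanielewskiPoints F d P)

      -- Both equations have the same right-hand side up to equality, and `α ^ d` can be cancelled
      -- because it has a left inverse. This serves both congruence and surjectivity of `point`.
      β-unique : ∀ {α α′ β β′ γ γ′} → ¬ α ≈ 0# → α ≈ α′ → γ ≈ γ′ →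
                 α ^ d · β ≈ eval F P γ → α′ ^ d · β′ ≈ eval F P γ′ → β ≈ β′
      β-unique {α} {α′} {β} {β′} {γ} {γ′} α≉0 α≈α′ γ≈γ′ eq eq′ =
        leftInverse⇒cancelˡ (^-leftInverse (proj₂ (≉0⇒leftInverse α≉0)) m) β β′ (begin
          α ^ d · β    ≈⟨ eq ⟩
          eval F P γ   ≈⟨ eval-cong P γ≈γ′ ⟩
          eval F P γ′  ≈⟨ eq′ ⟨
          α′ ^ d · β′  ≈⟨ *-congʳ (^-congˡ d α≈α′) ⟨
          α ^ d · β′   ∎)

      point : Pieces.Carrier → Points.Carrier
      point (inj₁ (β , γ , Pγ≈0)) = (0# , β , γ) , trans (0^suc*x≈0 m β) (sym Pγ≈0)
      -- Here the free factor is `γ`, and `β` is P(γ) divided by `α ^ d`, written with the inverse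
      -- `v` of `α`.
      point (inj₂ (γ , α , α≉0)) with v , vα≈1 ← ≉0⇒leftInverse α≉0 =
        (α , v ^ d · eval F P γ , γ) , (begin
          α ^ d · (v ^ d · eval F P γ)  ≈⟨ *-assoc _ _ _ ⟨
          α ^ d · v ^ d · eval F P γ    ≈⟨ *-congʳ (*-comm _ _) ⟩
          v ^ d · α ^ d · eval F P γ    ≈⟨ *-congʳ (^-leftInverse vα≈1 m) ⟩
          1# · eval F P γ               ≈⟨ *-identityˡ _ ⟩
          eval F P γ                    ∎)

      point-cong : ∀ {x y} → x Pieces.≈ y → point x Points.≈ point y
      point-cong (inj₁ (β≈β′ , γ≈γ′)) = refl , β≈β′ , γ≈γ′
      -- The inverses chosen for `α` and `α′` come from separate searches; instead of comparing
      -- them, uniqueness of `β` is applied to the two resulting points.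
      point-cong {inj₂ x@(γ , α , α≉0)} {inj₂ y} (inj₂ (γ≈γ′ , α≈α′)) =
        α≈α′ ,
        β-unique α≉0 α≈α′ γ≈γ′ (proj₂ (point (inj₂ x))) (proj₂ (point (inj₂ y))) ,
        γ≈γ′

      point-injective : ∀ {x y} → point x Points.≈ point y → x Pieces.≈ y
      point-injective {inj₁ _} {inj₁ _} (_ , β≈β′ , γ≈γ′) = inj₁ (β≈β′ , γ≈γ′)
      point-injective {inj₁ _} {inj₂ (_ , _ , α≉0)} (0≈α , _) = contradiction (sym 0≈α) α≉0
      point-injective {inj₂ (_ , _ , α≉0)} {inj₁ _} (α≈0 , _) = contradiction α≈0 α≉0
      point-injective {inj₂ _} {inj₂ _} (α≈α′ , _ , γ≈γ′) = inj₂ (γ≈γ′ , α≈α′)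

      point-surjective : ∀ y → ∃[ x ] point x Points.≈ y
      point-surjective ((α , β , γ) , eq) with α ≈? 0#
      ... | yes α≈0 = inj₁ (β , γ , Pγ≈0) , sym α≈0 , refl , refl
        where
        Pγ≈0 : eval F P γ ≈ 0#
        Pγ≈0 = begin
          eval F P γ  ≈⟨ eq ⟨
          α ^ d · β   ≈⟨ *-congʳ (^-congˡ d α≈0) ⟩
          0# ^ d · β  ≈⟨ 0^suc*x≈0 m β ⟩
          0#          ∎
      -- The given `β` and the one computed by `point` solve the same equation, so they agree.
      ... | no  α≉0 = inj₂ x , refl , β-unique α≉0 refl refl (proj₂ (point (inj₂ x))) eq , refl
        where x = γ , α , α≉0

    roots-cardinality : ∀ P → ∃[ N₀ ] Roots F P HasCardinality N₀
    roots-cardinality P = decSubset-cardinality ∣F∣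
      (λ y≈z Py≈0 → trans (eval-cong P (sym y≈z)) Py≈0) (λ γ → eval F P γ ≈? 0#)

    points-cardinality : ∀ m P {N₀} → Roots F P HasCardinality N₀ →
                         DanielewskiPoints F (suc m) P HasCardinality (q * N₀ + q * (q ∸ 1))
    points-cardinality m P ∣Roots∣ = Inv.trans
      (Inv.sym (points-decomposition m P))
      (⊎-cardinality (×-cardinality ∣F∣ ∣Roots∣)
                     (×-cardinality ∣F∣ (remove-cardinality ∣F∣ 0#)))

mainTheorem2 : ∀ {c ℓ₁ ℓ₂} (F : HeytingField c ℓ₁ ℓ₂) (q : ℕ) →
    fieldSetoid F HasCardinality q →
    (d : ℕ) → 1 ≤ d →
    (P : Polynomial F) (n : ℕ) → HasDegree F P n → 2 ≤ n →
    ∃[ N₀ ] (Roots F P HasCardinality N₀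
    × DanielewskiPoints F d P HasCardinality (q * N₀ + q * (q ∸ 1))
    × q * N₀ + q * (q ∸ 1) ≡ q * (q ∸ 1 + N₀))
-- Since `1 ≤ d`, only a successor exponent occurs. The last component is commutativity of the sum
-- followed by distributivity.
mainTheorem2 F q ∣F∣ (suc m) _ P _ _ _ with N₀ , ∣Roots∣ ← roots-cardinality F ∣F∣ P =
  N₀ , ∣Roots∣ , points-cardinality F ∣F∣ m P ∣Roots∣ ,
  ≡.trans (+-comm (q * N₀) (q * (q ∸ 1))) (≡.sym (*-distribˡ-+ q (q ∸ 1) N₀))
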